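{- Let $\langle O,\sqsubseteq,\triangleleft\rangle$ be a directed observation structure over a set $\mathbb{B}$, let $P\subseteq\mathbb{B}$ be a property and $o\in O$. Then the following are equivalent: (1) $\mathcal{M}_{\Gamma_{\mathbb{S}}(P)}(o)=\mathsf{yes}$ and $\mathcal{M}_{\Delta_{\mathsf{co}\mathbb{S}}(P)}(o)=\mathsf{no}$; (2) for every $o'\in O$ such that $o\sqsubseteq o'$, $\mathcal{M}_P(o')=\mathsf{?}$.
   Context: Let $\mathbb{B}$ be a set (of behaviours). A property is a subset $P\subseteq\mathbb{B}$. An observation structure over $\mathbb{B}$ is a preordered set $\langle O,\sqsubseteq\rangle$ (of observations) together with a relation $\triangleleft\subseteq O\times\mathbb{B}$ such that: (i) $o\sqsubseteq o'$ and $o'\triangleleft b$ imply $o\triangleleft b$; (ii) for every $o\in O$ there is $b\in\mathbb{B}$ with $o\triangleleft b$. It is directed if for all $o,o'\in O$ and $b\in\mathbb{B}$ with $o\triangleleft b$ and $o'\triangleleft b$ there is $o''\in O$ with $o''\triangleleft b$, $o\sqsubseteq o''$ and $o'\sqsubseteq o''$. Put $\mathbb{B}(o)=\{b\in\mathbb{B}\mid o\triangleleft b\}$. The abstract monitor of $P$ is the function $\mathcal{M}_P:O\to\{\mathsf{yes},\mathsf{no},\mathsf{?}\}$ with $\mathcal{M}_P(o)=\mathsf{yes}$ if $\mathbb{B}(o)\subseteq P$, $\mathcal{M}_P(o)=\mathsf{no}$ if $\mathbb{B}(o)\cap P=\emptyset$, and $\mathcal{M}_P(o)=\mathsf{?}$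 otherwise. $P$ is a safety property if for every $b\in\mathbb{B}\setminus P$ there is $o\in O$ with $o\triangleleft b$ and $\mathcal{M}_P(o)=\mathsf{no}$; $P$ is a cosafety property if for every $b\in P$ there is $o\in O$ with $o\triangleleft b$ and $\mathcal{M}_P(o)=\mathsf{yes}$. Let $\mathbb{S}$ and $\mathsf{co}\mathbb{S}$ be the sets of all safety, respectively cosafety, properties over $\mathbb{B}$. The safety completion of $P$ is $\Gamma_{\mathbb{S}}(P)=\bigcap\{Q\in\mathbb{S}\mid P\subseteq Q\}$ and the cosafety completion of $P$ is $\Delta_{\mathsf{co}\mathbb{S}}(P)=\bigcup\{Q\in\mathsf{co}\mathbb{S}\mid Q\subseteq P\}$. -}

module Defs where

open import Level using (Level; suc; _⊔_)
open import Axiom.ExcludedMiddle using (ExcludedMiddle)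
open import Data.Product using (∃; ∃-syntax; _×_; proj₁)
open import Relation.Binary.Core using (Rel; REL)
open import Relation.Binary.Structures using (IsPreorder)
open import Relation.Binary.PropositionalEquality using (_≡_)
import Relation.Nullary as Dec using (yes; no)
open import Relation.Unary using (Pred; _∈_; _∉_; _⊆_; _∩_; Empty; ⋂; ⋃)

record ObservationStructure {ℓ : Level} (𝔹 : Set ℓ) : Set (suc ℓ) where
  infix 4 _⊑_ _◁_
  field
    O          : Set ℓ
    _⊑_        : Rel O ℓ
    isPreorder : IsPreorder _≡_ _⊑_
    _◁_        : REL O 𝔹 ℓ
    ◁-down     : ∀ {o o′ b} → o ⊑ o′ → o′ ◁ b → o ◁ b
    ◁-total    : ∀ o → ∃[ b ] o ◁ b

  𝔹⟨_⟩ : O → Pred 𝔹 ℓ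
  𝔹⟨ o ⟩ b = o ◁ b

  Directed : Set ℓ
  Directed = ∀ {o o′ b} → o ◁ b → o′ ◁ b →
             ∃[ o″ ] (o″ ◁ b × o ⊑ o″ × o′ ⊑ o″)

data Verdict : Set where
  yes no unknown : Verdict

-- Excluded middle is what makes the monitor a total function: both of its
-- case distinctions are undecidable in general.  It is needed at every level
-- because the completions below quantify over all properties in Pred 𝔹 ℓ and
-- so live in Pred 𝔹 (suc ℓ); for the same reason the monitor accepts
-- properties of any level.

module Monitoring (em : ∀ {a} → ExcludedMiddle a)
                  {ℓ : Level} {𝔹 : Set ℓ} (S : ObservationStructure 𝔹) where

  open ObservationStructure S

  -- By ◁-total the first two cases exclude each other, so the order in which
  -- they are tried is irrelevant.
  monitor : ∀ {p} → Pred 𝔹 p → O → Verdict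
  monitor {p} P o with em {ℓ ⊔ p} {𝔹⟨ o ⟩ ⊆ P} | em {ℓ ⊔ p} {Empty (𝔹⟨ o ⟩ ∩ P)}
  ... | Dec.yes _ | _         = yes
  ... | Dec.no _  | Dec.yes _ = no
  ... | Dec.no _  | Dec.no _  = unknown

  Safety : Pred (Pred 𝔹 ℓ) ℓ
  Safety P = ∀ {b} → b ∉ P → ∃[ o ] (o ◁ b × monitor P o ≡ no)

  Cosafety : Pred (Pred 𝔹 ℓ) ℓ
  Cosafety P = ∀ {b} → b ∈ P → ∃[ o ] (o ◁ b × monitor P o ≡ yes)

  safetyCompletion : Pred 𝔹 ℓ → Pred 𝔹 (suc ℓ)
  safetyCompletion P = ⋂ (∃ λ Q → Q ∈ Safety × P ⊆ Q) proj₁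

  cosafetyCompletion : Pred 𝔹 ℓ → Pred 𝔹 (suc ℓ)
  cosafetyCompletion P = ⋃ (∃ λ Q → Q ∈ Cosafety × Q ⊆ P) proj₁

{-# OPTIONS --safe #-}
-- 𝔹⟨ o ⟩ is itself a cosafety property and its complement a safety property.
-- Hence a definite verdict for P at some o′ above o puts 𝔹⟨ o′ ⟩ inside the
-- cosafety completion or outside the safety completion of P.  Conversely, a
-- behaviour of o violating (1) has an observation o₁ witnessing this, and by
-- directedness o and o₁ have a common refinement, at which P gets a definite
-- verdict.
module Submission where

open import Defs
open import Axiom.DoubleNegationElimination using (em⇒dne)
open import Axiom.ExcludedMiddle using (ExcludedMiddle)
open import Data.Empty using (⊥-elim)
open import Data.Product using (_×_; _,_; proj₁; proj₂)
open import Function.Base using (_∘_; id)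
open import Function.Bundles using (_⇔_; mk⇔)
open import Level using (Level; _⊔_)
open import Relation.Binary.PropositionalEquality using (_≡_; refl)
import Relation.Nullary as Dec using (yes; no)
open import Relation.Nullary using (¬_)
open import Relation.Unary using (Pred; _⊆_; _∩_; ∁; Empty; _∈_)

module _ (em : ∀ {a} → ExcludedMiddle a)
         {ℓ : Level} {𝔹 : Set ℓ} (S : ObservationStructure 𝔹) where

  open ObservationStructure S
  open Monitoring em S

  -- The level `p` stays free because the properties monitored below live at level `ℓ`, but their
  -- completions one level higher.
  module _ {p} {P : Pred 𝔹 p} {o : O} where

    ⊆⇒yes : 𝔹⟨ o ⟩ ⊆ P → monitor P o ≡ yes
    ⊆⇒yes sub with em {ℓ ⊔ p} {𝔹⟨ o ⟩ ⊆ P} | em {ℓ ⊔ p} {Empty (𝔹⟨ o ⟩ ∩ P)}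
    ... | Dec.yes _   | _ = refl
    ... | Dec.no ¬sub | _ = ⊥-elim (¬sub sub)

    yes⇒⊆ : monitor P o ≡ yes → 𝔹⟨ o ⟩ ⊆ P
    yes⇒⊆ eq with em {ℓ ⊔ p} {𝔹⟨ o ⟩ ⊆ P} | em {ℓ ⊔ p} {Empty (𝔹⟨ o ⟩ ∩ P)}
    yes⇒⊆ _  | Dec.yes sub | _         = sub
    yes⇒⊆ () | Dec.no _    | Dec.yes _
    yes⇒⊆ () | Dec.no _    | Dec.no _

    empty⇒no : Empty (𝔹⟨ o ⟩ ∩ P) → monitor P o ≡ no
    empty⇒no dis with em {ℓ ⊔ p} {𝔹⟨ o ⟩ ⊆ P} | em {ℓ ⊔ p} {Empty (𝔹⟨ o ⟩ ∩ P)}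
    -- Some behaviour of `o` exists, and it would lie both in `P` and outside it.
    ... | Dec.yes sub | _           = let b , o◁b = ◁-total o in ⊥-elim (dis b (o◁b , sub o◁b))
    ... | Dec.no _    | Dec.yes _   = refl
    ... | Dec.no _    | Dec.no ¬dis = ⊥-elim (¬dis dis)

    no⇒empty : monitor P o ≡ no → Empty (𝔹⟨ o ⟩ ∩ P)
    no⇒empty eq with em {ℓ ⊔ p} {𝔹⟨ o ⟩ ⊆ P} | em {ℓ ⊔ p} {Empty (𝔹⟨ o ⟩ ∩ P)}
    no⇒empty () | Dec.yes _ | _
    no⇒empty _  | Dec.no _  | Dec.yes dis = dis
    no⇒empty () | Dec.no _  | Dec.no _

    indefinite⇒unknown : ¬ (𝔹⟨ o ⟩ ⊆ P) → ¬ Empty (𝔹⟨ o ⟩ ∩ P) → monitor P o ≡ unknown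
    indefinite⇒unknown ¬sub ¬dis
      with em {ℓ ⊔ p} {𝔹⟨ o ⟩ ⊆ P} | em {ℓ ⊔ p} {Empty (𝔹⟨ o ⟩ ∩ P)}
    ... | Dec.yes sub | _           = ⊥-elim (¬sub sub)
    ... | Dec.no _    | Dec.yes dis = ⊥-elim (¬dis dis)
    ... | Dec.no _    | Dec.no _    = refl

    unknown⇒⊈ : monitor P o ≡ unknown → ¬ (𝔹⟨ o ⟩ ⊆ P)
    -- Abstracting `monitor P o` turns `eq` into an equation between distinct verdicts.
    unknown⇒⊈ eq sub with monitor P o | ⊆⇒yes sub
    unknown⇒⊈ () sub | _ | refl

    unknown⇒nonempty : monitor P o ≡ unknown → ¬ Empty (𝔹⟨ o ⟩ ∩ P)
    unknown⇒nonempty eq dis with monitor P o | empty⇒no dis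
    unknown⇒nonempty () dis | _ | refl

  𝔹⟨⟩-cosafety : ∀ o → 𝔹⟨ o ⟩ ∈ Cosafety
  𝔹⟨⟩-cosafety o o◁b = o , o◁b , ⊆⇒yes id

  ∁𝔹⟨⟩-safety : ∀ o → ∁ 𝔹⟨ o ⟩ ∈ Safety
  -- The one observation `o` refutes the complement for each of its behaviours.
  ∁𝔹⟨⟩-safety o ¬¬o◁b = o , em⇒dne em ¬¬o◁b , empty⇒no λ _ (o◁b , ¬o◁b) → ¬o◁b o◁b

  module _ (P : Pred 𝔹 ℓ) (o : O) where

    completions⇒unknown :
      monitor (safetyCompletion P) o ≡ yes × monitor (cosafetyCompletion P) o ≡ no →
      ∀ o′ → o ⊑ o′ → monitor P o′ ≡ unknown
    completions⇒unknown (Γ-yes , Δ-no) o′ o⊑o′ = indefinite⇒unknown ¬sub ¬dis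
      where
      -- A behaviour of `o′` is also one of `o`, so both verdicts at `o` apply to it.
      b    = proj₁ (◁-total o′)
      o′◁b = proj₂ (◁-total o′)
      o◁b  = ◁-down o⊑o′ o′◁b

      ¬sub : ¬ (𝔹⟨ o′ ⟩ ⊆ P)
      ¬sub sub = no⇒empty Δ-no b (o◁b , (𝔹⟨ o′ ⟩ , 𝔹⟨⟩-cosafety o′ , sub) , o′◁b)

      ¬dis : ¬ Empty (𝔹⟨ o′ ⟩ ∩ P)
      -- If `o′` misses `P`, then `∁ 𝔹⟨ o′ ⟩` is a safety property above `P`, so it contains `b`,
      -- against `o′◁b`.
      ¬dis dis = yes⇒⊆ Γ-yes o◁b
        (∁ 𝔹⟨ o′ ⟩ , ∁𝔹⟨⟩-safety o′ , λ {c} c∈P o′◁c → dis c (o′◁c , c∈P)) o′◁b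

    unknown⇒completions :
      Directed → (∀ o′ → o ⊑ o′ → monitor P o′ ≡ unknown) →
      monitor (safetyCompletion P) o ≡ yes × monitor (cosafetyCompletion P) o ≡ no
    unknown⇒completions dir unk = ⊆⇒yes Γ-sub , empty⇒no Δ-dis
      where
      Γ-sub : 𝔹⟨ o ⟩ ⊆ safetyCompletion P
      Γ-sub o◁b (Q , Q-safe , P⊆Q) = em⇒dne em λ b∉Q →
        let o₁ , o₁◁b , Q-no = Q-safe b∉Q
            o₂ , _ , o⊑o₂ , o₁⊑o₂ = dir o◁b o₁◁b
        -- Behaviours of `o₂` are behaviours of `o₁`, hence outside `Q` and so outside `P`: the
        -- verdict at `o₂` would be `no`.
        in unknown⇒nonempty (unk o₂ o⊑o₂) λ c (o₂◁c , c∈P) →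
             no⇒empty Q-no c (◁-down o₁⊑o₂ o₂◁c , P⊆Q c∈P)

      Δ-dis : Empty (𝔹⟨ o ⟩ ∩ cosafetyCompletion P)
      Δ-dis b (o◁b , (Q , Q-cosafe , Q⊆P) , b∈Q) =
        let o₁ , o₁◁b , Q-yes = Q-cosafe b∈Q
            o₂ , _ , o⊑o₂ , o₁⊑o₂ = dir o◁b o₁◁b
        -- The chain `𝔹⟨ o₂ ⟩ ⊆ 𝔹⟨ o₁ ⟩ ⊆ Q ⊆ P` would force `yes` at `o₂`.
        in unknown⇒⊈ (unk o₂ o⊑o₂) (Q⊆P ∘ yes⇒⊆ Q-yes ∘ ◁-down o₁⊑o₂)

proposition7 :
    (em : ∀ {a} → ExcludedMiddle a) →
    ∀ {ℓ} {𝔹 : Set ℓ} (S : ObservationStructure 𝔹) →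
    let open ObservationStructure S
        open Monitoring em S in
    Directed →
    (P : Pred 𝔹 ℓ) (o : O) →
    (monitor (safetyCompletion P) o ≡ yes × monitor (cosafetyCompletion P) o ≡ no)
      ⇔ (∀ o′ → o ⊑ o′ → monitor P o′ ≡ unknown)
proposition7 em S dir P o =
  mk⇔ (completions⇒unknown em S P o) (unknown⇒completions em S P o dir)
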